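{- Let $x_i$ ($i \ge 0$), $y_{i,j}$ ($0 \le i \le j$), $u$ and $v$ be commuting indeterminates. For a nonempty finite set $A$ of nonnegative integers put $\Theta_A = 1$ if $|A| = 1$, and if $|A| > 1$ put $$\Theta_A = x_{\min(A)}\, y_{\max(A),\max(A)} \prod_{i \in A \setminus \{\max(A),\min(A)\}} \left( y_{i,i}\sum_{\substack{j \in A \\ j \leq i}} x_j + x_i \sum_{\substack{j \in A \\ j > i}} y_{i,j} \right).$$ Then for any finite set $A$ of positive integers, $$\left. \Theta_{A \cup \{0\}} \right|_{x_0 = u + v} = \sum_{B \sqcup C = A} \left. \Theta_{B \cup \{0\}} \right|_{x_0 = u} \left. \Theta_{C \cup \{0\}} \right|_{x_0 = v},$$ where the sum is over all ordered pairs $(B,C)$ of (possibly empty) sets with $B \cup C = A$ and $B \cap C = \emptyset$.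
   Context: The notation $|_{x_0 = z}$ means substituting $z$ for the indeterminate $x_0$ in the polynomial. -}

module Defs where

open import Algebra.Bundles using (CommutativeRing)
open import Data.Bool.Base using (if_then_else_)
import Data.Bool.Properties as Bool
open import Data.Empty using (⊥-elim-irr)
open import Data.Fin.Base using (Fin; zero; suc; toℕ)
import Data.Fin.Properties as Fin
open import Data.Fin.Subset
  using (Subset; inside; outside; Nonempty; ⁅_⁆; _∪_; _∩_; _-_; ∣_∣; ⊥)
open import Data.Fin.Subset.Properties using (_∈?_; nonempty?; x∈⁅x⁆; q⊆p∪q)
open import Data.List.Base
  using (List; []; _∷_; _++_; map; mapMaybe; foldr; allFin; cartesianProduct)
import Data.Maybe.Base as Maybe
open import Data.Nat.Base using (ℕ; zero; suc; _≤_)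
import Data.Nat.Properties as ℕ
open import Data.Product.Base using (_×_; _,_; proj₁)
open import Data.Vec.Base using ([]; _∷_; here; there)
open import Data.Vec.Properties using (≡-dec)
open import Level using (0ℓ)
open import Relation.Binary.PropositionalEquality.Core using (_≡_)
open import Relation.Nullary.Decidable.Core using (Dec; yes; no; does; dec⇒maybe; _×-dec_)
open import Relation.Unary using (Pred; Decidable)

private
  variable
    n : ℕ

------------------------------------------------------------------------
-- Polynomials with integer coefficients

-- The ring ℤ[ V ] of polynomials in commuting indeterminates V, as the
-- free commutative ring on V: ring expressions, considered up to the
-- least congruence _≈_ satisfying the commutative ring axioms.

infix  8 -_
infixl 7 _*_
infixl 6 _+_
infix  4 _≈_

data ℤ[_] (V : Set) : Set where
  var     : V → ℤ[ V ]
  0# 1#   : ℤ[ V ]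
  _+_ _*_ : ℤ[ V ] → ℤ[ V ] → ℤ[ V ]
  -_      : ℤ[ V ] → ℤ[ V ]

data _≈_ {V : Set} : ℤ[ V ] → ℤ[ V ] → Set where
  refl        : ∀ {p} → p ≈ p
  sym         : ∀ {p q} → p ≈ q → q ≈ p
  trans       : ∀ {p q r} → p ≈ q → q ≈ r → p ≈ r
  +-cong      : ∀ {p p′ q q′} → p ≈ p′ → q ≈ q′ → p + q ≈ p′ + q′
  *-cong      : ∀ {p p′ q q′} → p ≈ p′ → q ≈ q′ → p * q ≈ p′ * q′
  -‿cong      : ∀ {p p′} → p ≈ p′ → - p ≈ - p′
  +-assoc     : ∀ p q r → (p + q) + r ≈ p + (q + r)
  +-comm      : ∀ p q → p + q ≈ q + p
  +-identityˡ : ∀ p → 0# + p ≈ p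
  -‿inverseˡ  : ∀ p → - p + p ≈ 0#
  *-assoc     : ∀ p q r → (p * q) * r ≈ p * (q * r)
  *-comm      : ∀ p q → p * q ≈ q * p
  *-identityˡ : ∀ p → 1# * p ≈ p
  distribˡ    : ∀ p q r → p * (q + r) ≈ p * q + p * r

polynomialRing : Set → CommutativeRing 0ℓ 0ℓ
polynomialRing V = record
  { Carrier = ℤ[ V ] ; _≈_ = _≈_ ; _+_ = _+_ ; _*_ = _*_ ; -_ = -_ ; 0# = 0# ; 1# = 1#
  ; isCommutativeRing = record
    { isRing = record
      { +-isAbelianGroup = record
        { isGroup = record
          { isMonoid = record
            { isSemigroup = record
              { isMagma = record
                { isEquivalence = record { refl = refl ; sym = sym ; trans = trans }
                ; ∙-cong = +-cong
                }
              ; assoc = +-assoc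
              }
            ; identity = +-identityˡ , λ p → trans (+-comm p 0#) (+-identityˡ p)
            }
          ; inverse = -‿inverseˡ , λ p → trans (+-comm p (- p)) (-‿inverseˡ p)
          ; ⁻¹-cong = -‿cong
          }
        ; comm = +-comm
        }
      ; *-cong = *-cong
      ; *-assoc = *-assoc
      ; *-identity = *-identityˡ , λ p → trans (*-comm p 1#) (*-identityˡ p)
      ; distrib = distribˡ , λ p q r →
          trans (*-comm (q + r) p)
            (trans (distribˡ p q r) (+-cong (*-comm p q) (*-comm p r)))
      }
    ; *-comm = *-comm
    }
  }

module Evaluation {c ℓ} (R : CommutativeRing c ℓ) {V : Set}
                  (ρ : V → CommutativeRing.Carrier R) where
  private module R = CommutativeRing R

  eval : ℤ[ V ] → R.Carrier
  eval (var w) = ρ w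
  eval 0#      = R.0#
  eval 1#      = R.1#
  eval (p + q) = eval p R.+ eval q
  eval (p * q) = eval p R.* eval q
  eval (- p)   = R.- eval p

  eval-cong : ∀ {p q} → p ≈ q → eval p R.≈ eval q
  eval-cong refl              = R.refl
  eval-cong (sym e)           = R.sym (eval-cong e)
  eval-cong (trans e f)       = R.trans (eval-cong e) (eval-cong f)
  eval-cong (+-cong e f)      = R.+-cong (eval-cong e) (eval-cong f)
  eval-cong (*-cong e f)      = R.*-cong (eval-cong e) (eval-cong f)
  eval-cong (-‿cong e)        = R.-‿cong (eval-cong e)
  eval-cong (+-assoc p q r)   = R.+-assoc _ _ _
  eval-cong (+-comm p q)      = R.+-comm _ _
  eval-cong (+-identityˡ p)   = R.+-identityˡ _
  eval-cong (-‿inverseˡ p)    = R.-‿inverseˡ _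
  eval-cong (*-assoc p q r)   = R.*-assoc _ _ _
  eval-cong (*-comm p q)      = R.*-comm _ _
  eval-cong (*-identityˡ p)   = R.*-identityˡ _
  eval-cong (distribˡ p q r)  = R.distribˡ _ _ _

------------------------------------------------------------------------
-- The indeterminates

-- The bound in y is irrelevant, so that there is exactly one y i j for
-- all i ≤ j.
data Indeterminate : Set where
  x   : ℕ → Indeterminate
  y   : (i j : ℕ) → .(i ≤ j) → Indeterminate
  u v : Indeterminate

Poly : Set
Poly = ℤ[ Indeterminate ]

substitution : Poly → Indeterminate → Poly
substitution z (x zero) = z
substitution z w        = var w

infix 9 _∣x₀=_

_∣x₀=_ : Poly → Poly → Poly
p ∣x₀= z = Evaluation.eval (polynomialRing Indeterminate) (substitution z) p

∣x₀=-cong : ∀ {p q} z → p ≈ q → p ∣x₀= z ≈ q ∣x₀= z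
∣x₀=-cong z = Evaluation.eval-cong (polynomialRing Indeterminate) (substitution z)

------------------------------------------------------------------------
-- Sums and products over the entries of a list satisfying a predicate

module _ {I : Set} {P : Pred I 0ℓ} where

  -- The proof of P i is available to the summand, as y i j needs i ≤ j.
  terms : List I → Decidable P → (∀ i → P i → Poly) → List Poly
  terms is P? f = mapMaybe (λ i → Maybe.map (f i) (dec⇒maybe (P? i))) is

  ∑[_∣_] : List I → Decidable P → (∀ i → P i → Poly) → Poly
  ∑[ is ∣ P? ] f = foldr _+_ 0# (terms is P? f)

  ∏[_∣_] : List I → Decidable P → (∀ i → P i → Poly) → Poly
  ∏[ is ∣ P? ] f = foldr _*_ 1# (terms is P? f)

------------------------------------------------------------------------
-- Finite sets of nonnegative integers

-- Subset n consists of the sets A ⊆ {0, …, n - 1}; every finite set of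
-- nonnegative integers is of this form for some n.

min : (A : Subset n) → .(Nonempty A) → Fin n
min []            ne = ⊥-elim-irr (Fin.¬Fin0 (proj₁ ne))
min (inside  ∷ A) _  = zero
min (outside ∷ A) ne = suc (min A (tail ne))
  where
  tail : Nonempty (outside ∷ A) → Nonempty A
  tail (suc i , there i∈A) = i , i∈A

-- In the last clause the set, being nonempty, is { 0 }.
max : (A : Subset n) → .(Nonempty A) → Fin n
max []      ne = ⊥-elim-irr (Fin.¬Fin0 (proj₁ ne))
max (_ ∷ A) _ with nonempty? A
... | yes ne = suc (max A ne)
... | no  _  = zero

subsets : ∀ n → List (Subset n)
subsets zero    = [] ∷ []
subsets (suc n) = map (outside ∷_) (subsets n) ++ map (inside ∷_) (subsets n)

pairs : ∀ n → List (Subset n × Subset n)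
pairs n = cartesianProduct (subsets n) (subsets n)

infix 4 _≟_

_≟_ : (A B : Subset n) → Dec (A ≡ B)
_≟_ = ≡-dec Bool._≟_

_⊔_≟_ : (B C A : Subset n) → Dec (B ∪ C ≡ A × B ∩ C ≡ ⊥)
B ⊔ C ≟ A = B ∪ C ≟ A ×-dec B ∩ C ≟ ⊥

∪⁅0⁆-nonempty : (A : Subset (suc n)) → Nonempty (A ∪ ⁅ zero ⁆)
∪⁅0⁆-nonempty A = zero , q⊆p∪q A ⁅ zero ⁆ (x∈⁅x⁆ zero)

------------------------------------------------------------------------
-- The polynomial Θ

factor : Subset n → Fin n → Poly
factor {n} A i =
    var (y (toℕ i) (toℕ i) ℕ.≤-refl)
      * ∑[ allFin n ∣ (λ j → j ∈? A ×-dec j Fin.≤? i) ] (λ j _ → var (x (toℕ j)))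
  + var (x (toℕ i))
      * ∑[ allFin n ∣ (λ j → j ∈? A ×-dec i Fin.<? j) ]
          (λ j (_ , i<j) → var (y (toℕ i) (toℕ j) (ℕ.<⇒≤ i<j)))

Θ : (A : Subset n) → .(Nonempty A) → Poly
Θ {n} A ne =
  if does (∣ A ∣ ℕ.≟ 1)
  then 1#
  else var (x (toℕ a)) * var (y (toℕ b) (toℕ b) ℕ.≤-refl)
         * ∏[ allFin n ∣ (λ i → i ∈? (A - b - a)) ] (λ i _ → factor A i)
  where
  a b : Fin n
  a = min A ne
  b = max A ne

{-# OPTIONS --safe #-}

-- Work in the algebra of squarefree generating functions ∑_A c_A ε_A, the ring
-- generated by ε₁, …, εₙ with εᵢ² = 0: its product sums over ordered
-- decompositions A = B ⊔ C, so the theorem says F(u + v) = F(u) F(v), where F(s)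
-- has coefficients Θ_{A ∪ {0}} at x₀ = s.  Write F(s) = 1 + s G(s).  Splitting
-- off the least positive element, with generator ε, replaces G(s) by
--   G(s) + ε (y F(s + x) + x ∂G(s + x)),
-- where x = x₁, y = y₁₁ and ∂ is the derivation εⱼ ↦ y₁ⱼ εⱼ.  For every
-- derivation of this diagonal kind one has ∂G(s) = ∂G(0) F(s), so the new F(s)
-- is F(s)(1 + ε s P) with P = F(x)(y + x ∂G(0)) independent of s.  Both
-- F(s + t) = F(s) F(t) and ∂G(s) = ∂G(0) F(s) thereby pass from n to n + 1.
module Submission where

open import Algebra.Bundles using (CommutativeMonoid; CommutativeRing; CommutativeSemiring)
import Algebra.Construct.DirectProduct as DirectProduct
open import Algebra.Core using (Op₂)
open import Algebra.Definitions using (Congruent₂)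
import Algebra.Solver.Ring.NaturalCoefficients.Default as SemiringSolver
open import Algebra.Structures.Biased using (isCommutativeSemiringˡ)
open import Data.Bool.Base using (if_then_else_)
open import Data.Bool.Properties using (∧-zeroʳ)
open import Data.Fin.Base as Fin using (Fin; zero; suc; toℕ)
import Data.Fin.Properties as Fin
open import Data.Fin.Subset
  using (Subset; inside; outside; Nonempty; ⊥; ⁅_⁆; _∈_; _∉_; _∪_; _-_; _─_; ∣_∣)
open import Data.Fin.Subset.Properties
  using (nonempty?; Empty-unique; p─⊥≡p; ∉⊥; _∈?_; ∣⊥∣≡0; drop-there; ∪-identityʳ)
open import Data.List.Base
  using (List; []; _∷_; _++_; map; foldr; tabulate; allFin; cartesianProduct)
open import Data.Nat.Base using (ℕ; zero; suc; _≤_; z≤n; s≤s)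
import Data.Nat.Properties as ℕ
open import Data.Product.Base using (_×_; _,_; proj₁; proj₂)
open import Data.Vec.Base using ([]; _∷_; here; there)
open import Function.Base using (_∘_; id)
open import Level using (0ℓ)
import Relation.Binary.PropositionalEquality.Core as ≡
open ≡ using (_≡_; _≢_)
import Relation.Binary.Reasoning.Setoid as SetoidReasoning
open import Relation.Nullary using (yes; no; does; contradiction; _×-dec_)
open import Relation.Unary using (Pred; Decidable)
import Defs

-- Squarefree generating functions

module _ {c ℓ} (R : CommutativeSemiring c ℓ) where
  open CommutativeSemiring R
  open SemiringSolver R using (solve; _:=_; _:+_; _:*_; con)

  -- R[ε]/(ε²), with (a , b) standing for a + bε.
  dualNumbers : CommutativeSemiring c ℓ
  dualNumbers = record
    { Carrier = Carrier × Carrier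
    ; _≈_ = Additive._≈_
    ; _+_ = Additive._∙_
    ; _*_ = λ (a , b) (a′ , b′) → a * a′ , a * b′ + b * a′
    ; 0#  = Additive.ε
    ; 1#  = 1# , 0#
    ; isCommutativeSemiring = isCommutativeSemiringˡ record
      { +-isCommutativeMonoid = Additive.isCommutativeMonoid
      ; *-isCommutativeMonoid = record
        { isMonoid = record
          { isSemigroup = record
            { isMagma = record
              { isEquivalence = Additive.isEquivalence
              ; ∙-cong = λ (a≈ , b≈) (a′≈ , b′≈) →
                  *-cong a≈ a′≈ , +-cong (*-cong a≈ b′≈) (*-cong b≈ a′≈)
              }
            ; assoc = λ (a , b) (a′ , b′) (a″ , b″) →
                *-assoc a a′ a″ ,
                solve 6 (λ a b a′ b′ a″ b″ →
                  (a :* a′) :* b″ :+ (a :* b′ :+ b :* a′) :* a″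
                    := a :* (a′ :* b″ :+ b′ :* a″) :+ b :* (a′ :* a″))
                  refl a b a′ b′ a″ b″
            }
          ; identity =
              (λ (a , b) → *-identityˡ a ,
                solve 2 (λ a b → con 1 :* b :+ con 0 :* a := b) refl a b)
            , (λ (a , b) → *-identityʳ a ,
                solve 2 (λ a b → a :* con 0 :+ b :* con 1 := b) refl a b)
          }
        ; comm = λ (a , b) (a′ , b′) → *-comm a a′ ,
            solve 4 (λ a b a′ b′ → a :* b′ :+ b :* a′ := a′ :* b :+ b′ :* a)
              refl a b a′ b′
        }
      ; distribʳ = λ (a , b) (a′ , b′) (a″ , b″) → distribʳ a a′ a″ ,
          solve 6 (λ a b a′ b′ a″ b″ →
            (a′ :+ a″) :* b :+ (b′ :+ b″) :* a
              := (a′ :* b :+ b′ :* a) :+ (a″ :* b :+ b″ :* a))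
            refl a b a′ b′ a″ b″
      ; zeroˡ = λ (a , b) → zeroˡ a ,
          solve 2 (λ a b → con 0 :* b :+ con 0 :* a := con 0) refl a b
      }
    }
    where
    module Additive = CommutativeMonoid
      (DirectProduct.commutativeMonoid +-commutativeMonoid +-commutativeMonoid)

-- `y` stands for the diagonal y_{i,i} and `z` for y_{i,j} with i < j. Making `z` total keeps proofs
-- of inequalities out of the algebra.
record Weights {c} (K : Set c) (n : ℕ) : Set c where
  field
    x y : Fin n → K
    z   : Fin n → Fin n → K

module Squarefree {c ℓ} (R : CommutativeSemiring c ℓ) where
  private module R = CommutativeSemiring R

  -- The outermost ε belongs to the least position, matching the head of a `Subset`.
  algebra : ℕ → CommutativeSemiring c ℓ
  algebra zero    = R
  algebra (suc n) = dualNumbers (algebra n)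

  private
    module E (n : ℕ) where
      open CommutativeSemiring (algebra n) public hiding (zero)
      open SemiringSolver (algebra n) public using (solve; _:=_; _:+_; _:*_; con)
      open SetoidReasoning setoid public
  open Weights

  -- Constants and diagonal derivations.

  ι : ∀ n → R.Carrier → E.Carrier n
  ι zero    r = r
  ι (suc n) r = ι n r , E.0# n

  ι-cong : ∀ n {r s} → r R.≈ s → let open E n in ι n r ≈ ι n s
  ι-cong zero    r≈s = r≈s
  ι-cong (suc n) r≈s = ι-cong n r≈s , E.refl n

  ι-+ : ∀ n r s → let open E n in ι n (r R.+ s) ≈ ι n r + ι n s
  ι-+ zero    r s = R.refl
  ι-+ (suc n) r s = ι-+ n r s , sym (+-identityˡ 0#)
    where open E n

  -- The derivation sending the i-th generator εᵢ to wᵢ εᵢ.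
  ∂ : ∀ n → (Fin n → R.Carrier) → E.Carrier n → E.Carrier n
  ∂ zero    w _       = R.0#
  ∂ (suc n) w (f , g) = ∂ n (w ∘ suc) f , ι n (w zero) * g + ∂ n (w ∘ suc) g
    where open E n

  ∂-cong : ∀ n w {f g} → let open E n in f ≈ g → ∂ n w f ≈ ∂ n w g
  ∂-cong zero    w _       = R.refl
  ∂-cong (suc n) w (p , q) =
    ∂-cong n (w ∘ suc) p , +-cong (*-congˡ q) (∂-cong n (w ∘ suc) q)
    where open E n

  ∂-+ : ∀ n w f g → let open E n in ∂ n w (f + g) ≈ ∂ n w f + ∂ n w g
  ∂-+ zero    w _       _         = R.sym (R.+-identityˡ R.0#)
  ∂-+ (suc n) w (f , g) (f′ , g′) =
    ∂-+ n (w ∘ suc) f f′ ,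
    trans (+-congˡ (∂-+ n (w ∘ suc) g g′))
      (solve 5 (λ w₀ g g′ a b →
          w₀ :* (g :+ g′) :+ (a :+ b) := (w₀ :* g :+ a) :+ (w₀ :* g′ :+ b))
        refl (ι n (w zero)) g g′ (∂ n (w ∘ suc) g) (∂ n (w ∘ suc) g′))
    where open E n

  -- Each term in the ε-component of a product contains ε once, so the weight of ε falls on exactly
  -- one of the two factors.
  ∂-* : ∀ n w f g → let open E n in ∂ n w (f * g) ≈ ∂ n w f * g + f * ∂ n w g
  ∂-* zero    w f g = solve 2 (λ f g → con 0 := con 0 :* g :+ f :* con 0) R.refl f g
    where open E 0
  ∂-* (suc n) w (f , g) (f′ , g′) =
    ∂-* n w′ f f′ ,
    trans (+-congˡ (trans (∂-+ n w′ (f * g′) (g * f′))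
                          (+-cong (∂-* n w′ f g′) (∂-* n w′ g f′))))
      (solve 9 (λ w₀ f g f′ g′ df dg df′ dg′ →
          w₀ :* (f :* g′ :+ g :* f′)
            :+ ((df :* g′ :+ f :* dg′) :+ (dg :* f′ :+ g :* df′))
          := (df :* g′ :+ (w₀ :* g :+ dg) :* f′)
            :+ (f :* (w₀ :* g′ :+ dg′) :+ g :* df′))
        refl (ι n (w zero)) f g f′ g′
        (∂ n w′ f) (∂ n w′ g) (∂ n w′ f′) (∂ n w′ g′))
    where
    open E n
    w′ = w ∘ suc

  ∂-0 : ∀ n w → let open E n in ∂ n w 0# ≈ 0#
  ∂-0 zero    w = R.refl
  ∂-0 (suc n) w = ∂-0 n (w ∘ suc) ,
    trans (+-cong (zeroʳ _) (∂-0 n (w ∘ suc))) (+-identityˡ 0#)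
    where open E n

  ∂-ι : ∀ n w r → let open E n in ∂ n w (ι n r) ≈ 0#
  ∂-ι zero    w r = R.refl
  ∂-ι (suc n) w r = ∂-ι n (w ∘ suc) r ,
    trans (+-cong (zeroʳ _) (∂-0 n (w ∘ suc))) (+-identityˡ 0#)
    where open E n

  ∂-1 : ∀ n w → let open E n in ∂ n w 1# ≈ 0#
  ∂-1 zero    w = R.refl
  ∂-1 (suc n) w = ∂-1 n (w ∘ suc) ,
    trans (+-cong (zeroʳ _) (∂-0 n (w ∘ suc))) (+-identityˡ 0#)
    where open E n

  -- The generating functions and their recursion.

  tail : ∀ {n} → Weights R.Carrier (suc n) → Weights R.Carrier n
  tail d .x i   = x d (suc i)
  tail d .y i   = y d (suc i)
  tail d .z i j = z d (suc i) (suc j)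

  -- For nonempty A, the coefficient of F at ∏_{i ∈ A} εᵢ is Θ_{A ∪ {0}} with
  -- x₀ = s, and that of G is its quotient by s.
  F G : ∀ n → Weights R.Carrier n → R.Carrier → E.Carrier n
  -- The coefficient of the least generator. If larger elements follow, the least one contributes
  -- the factor y(s + x) + x ∂ applied to G(s + x), its x joining s in every later factor. The
  -- constant term 1 of F covers the case where it is also the greatest.
  Q : ∀ n → Weights R.Carrier (suc n) → R.Carrier → E.Carrier n

  F n d s = 1# + ι n s * G n d s
    where open E n
  G zero    d s = R.0#
  G (suc n) d s = G n (tail d) s , Q n d s
  Q n d s = ι n (y d zero) * F n (tail d) (s R.+ x d zero)
    + ι n (x d zero) * ∂ n (λ j → z d zero (suc j)) (G n (tail d) (s R.+ x d zero))
    where open E n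

  -- The constants 1 and s have derivative 0, so only G is differentiated.
  ∂-F : ∀ n w d s → let open E n in ∂ n w (F n d s) ≈ ι n s * ∂ n w (G n d s)
  ∂-F n w d s = begin
    ∂ n w (1# + ι n s * G n d s)
      ≈⟨ ∂-+ n w 1# _ ⟩
    ∂ n w 1# + ∂ n w (ι n s * G n d s)
      ≈⟨ +-cong (∂-1 n w) (trans (∂-* n w _ _) (+-congʳ (*-congʳ (∂-ι n w s)))) ⟩
    0# + (0# * G n d s + ι n s * ∂ n w (G n d s))
      ≈⟨ solve 3 (λ g s h → con 0 :+ (con 0 :* g :+ s :* h) := s :* h)
           refl (G n d s) (ι n s) (∂ n w (G n d s)) ⟩
    ι n s * ∂ n w (G n d s) ∎
    where open E n

  G-cong : ∀ n d {s t} → s R.≈ t → let open E n in G n d s ≈ G n d t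
  F-cong : ∀ n d {s t} → s R.≈ t → let open E n in F n d s ≈ F n d t
  G-cong zero    d s≈t = R.refl
  G-cong (suc n) d s≈t = G-cong n (tail d) s≈t ,
    +-cong (*-congˡ (F-cong n (tail d) s+x≈t+x))
           (*-congˡ (∂-cong n _ (G-cong n (tail d) s+x≈t+x)))
    where
    open E n
    s+x≈t+x = R.+-congʳ s≈t
  F-cong n d s≈t = +-congˡ (*-cong (ι-cong n s≈t) (G-cong n d s≈t))
    where open E n

  -- The addition law.

  F-suc : ∀ n d s →
    E._≈_ (suc n) (F (suc n) d s) (F n (tail d) s , E._*_ n (ι n s) (Q n d s))
  F-suc n d s = refl ,
    solve 3 (λ s q g → con 0 :+ (s :* q :+ con 0 :* g) := s :* q)
      refl (ι n s) (Q n d s) (G n (tail d) s)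
    where open E n

  -- Mutual induction: `Q-factor` at n uses `F-+` and `∂-G` at n, and these two at `suc n` use
  -- `Q-factor` at n.
  F-+ : ∀ n d s t → let open E n in F n d (s R.+ t) ≈ F n d s * F n d t
  -- Over the rationals the addition law gives F(s) = exp(s G(0)), so s ∂G(s) = ∂F(s) = s ∂G(0)
  -- F(s). Cancelling s suggests this form, which is proved without division.
  ∂-G : ∀ n w d s → let open E n in ∂ n w (G n d s) ≈ ∂ n w (G n d R.0#) * F n d s

  -- Both terms of Q carry the factor F(s + x₀) = F(s) F(x₀), so s enters only through F(s).
  Q-factor : ∀ n d s → let open E n in Q n d s ≈ F n (tail d) s * Q n d R.0#
  Q-factor n d s = begin
    Y * F n d′ (s R.+ x₀) + X * ∂ n w (G n d′ (s R.+ x₀))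
      ≈⟨ +-cong (*-congˡ (F-+ n d′ s x₀)) (*-congˡ (∂-G n w d′ (s R.+ x₀))) ⟩
    Y * (F n d′ s * F n d′ x₀) + X * (K * F n d′ (s R.+ x₀))
      ≈⟨ +-congˡ (*-congˡ (*-congˡ (F-+ n d′ s x₀))) ⟩
    Y * (F n d′ s * F n d′ x₀) + X * (K * (F n d′ s * F n d′ x₀))
      ≈⟨ solve 5 (λ Y X K f g → Y :* (f :* g) :+ X :* (K :* (f :* g))
                    := f :* (Y :* g :+ X :* (K :* g)))
           refl Y X K (F n d′ s) (F n d′ x₀) ⟩
    F n d′ s * (Y * F n d′ x₀ + X * (K * F n d′ x₀))
      -- Reading `∂-G` backwards at x₀ turns the cofactor of F(s) into Q at 0, where the shifted
      -- argument is 0 + x₀.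
      ≈⟨ *-congˡ (+-cong (*-congˡ (F-cong n d′ x₀≈0+x₀))
           (*-congˡ (trans (sym (∂-G n w d′ x₀)) (∂-cong n w (G-cong n d′ x₀≈0+x₀))))) ⟩
    F n d′ s * Q n d R.0# ∎
    where
    open E n
    d′ = tail d
    x₀ = x d zero
    w = λ j → z d zero (suc j)
    X = ι n x₀
    Y = ι n (y d zero)
    K = ∂ n w (G n d′ R.0#)
    x₀≈0+x₀ = R.sym (R.+-identityˡ x₀)

  F-+ zero    d s t = solve 2 (λ s t → con 1 :+ (s :+ t) :* con 0
    := (con 1 :+ s :* con 0) :* (con 1 :+ t :* con 0)) R.refl s t
    where open E 0
  F-+ (suc n) d s t = E′.trans (F-suc n d (s R.+ t))
    (E′.trans (F-+ n d′ s t , second)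
      (E′.sym (E′.*-cong (F-suc n d s) (F-suc n d t))))
    where
    open E n
    module E′ = E (suc n)
    d′ = tail d
    P = Q n d R.0#
    second : ι n (s R.+ t) * Q n d (s R.+ t)
      ≈ F n d′ s * (ι n t * Q n d t) + ι n s * Q n d s * F n d′ t
    second = begin
      ι n (s R.+ t) * Q n d (s R.+ t)
        ≈⟨ *-cong (ι-+ n s t) (trans (Q-factor n d (s R.+ t)) (*-congʳ (F-+ n d′ s t))) ⟩
      (ι n s + ι n t) * (F n d′ s * F n d′ t * P)
        -- This is the ε-component of F(s)(1 + ε s P) times F(t)(1 + ε t P): as ε² = 0, the
        -- parameters s and t add.
        ≈⟨ solve 5 (λ s t f g p → (s :+ t) :* (f :* g :* p)
                      := f :* (t :* (g :* p)) :+ s :* (f :* p) :* g)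
             refl (ι n s) (ι n t) (F n d′ s) (F n d′ t) P ⟩
      F n d′ s * (ι n t * (F n d′ t * P)) + ι n s * (F n d′ s * P) * F n d′ t
        ≈⟨ +-cong (*-congˡ (*-congˡ (Q-factor n d t))) (*-congʳ (*-congˡ (Q-factor n d s))) ⟨
      F n d′ s * (ι n t * Q n d t) + ι n s * Q n d s * F n d′ t ∎

  ∂-G zero    w d s = R.sym (R.zeroˡ _)
  ∂-G (suc n) w d s = E′.trans (∂-G n w′ d′ s , second)
    (E′.sym (E′.*-congˡ {∂ (suc n) w (G (suc n) d R.0#)} (F-suc n d s)))
    where
    open E n
    module E′ = E (suc n)
    d′ = tail d
    w′ = w ∘ suc
    w₀ = ι n (w zero)
    P = Q n d R.0#
    K = ∂ n w′ (G n d′ R.0#)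
    second : w₀ * Q n d s + ∂ n w′ (Q n d s)
      ≈ K * (ι n s * Q n d s) + (w₀ * P + ∂ n w′ P) * F n d′ s
    second = begin
      w₀ * Q n d s + ∂ n w′ (Q n d s)
        ≈⟨ +-cong (*-congˡ (Q-factor n d s))
             (trans (∂-cong n w′ (Q-factor n d s)) (∂-* n w′ _ _)) ⟩
      w₀ * (F n d′ s * P) + (∂ n w′ (F n d′ s) * P + F n d′ s * ∂ n w′ P)
        -- With ∂F(s) = s ∂G(s) and the induction hypothesis, every term acquires the factor F(s).
        ≈⟨ +-congˡ (+-congʳ (*-congʳ
             (trans (∂-F n w′ d′ s) (*-congˡ (∂-G n w′ d′ s))))) ⟩
      w₀ * (F n d′ s * P) + (ι n s * (K * F n d′ s) * P + F n d′ s * ∂ n w′ P)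
        ≈⟨ solve 6 (λ w₀ f p s k dp →
             w₀ :* (f :* p) :+ (s :* (k :* f) :* p :+ f :* dp)
               := k :* (s :* (f :* p)) :+ (w₀ :* p :+ dp) :* f)
             refl w₀ (F n d′ s) P (ι n s) K (∂ n w′ P) ⟩
      K * (ι n s * (F n d′ s * P)) + (w₀ * P + ∂ n w′ P) * F n d′ s
        ≈⟨ +-congʳ (*-congˡ (*-congˡ (Q-factor n d s))) ⟨
      K * (ι n s * Q n d s) + (w₀ * P + ∂ n w′ P) * F n d′ s ∎

-- Coefficients

fold : ∀ {a n} {A : Set a} → (A → A → A) → A → Subset n → (Fin n → A) → A
fold _∙_ ε []            f = ε
fold _∙_ ε (outside ∷ S) f = fold _∙_ ε S (f ∘ suc)
fold _∙_ ε (inside  ∷ S) f = f zero ∙ fold _∙_ ε S (f ∘ suc)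

fold-⊥ : ∀ {a} {A : Set a} n (_∙_ : A → A → A) ε (f : Fin n → A) → fold _∙_ ε ⊥ f ≡ ε
fold-⊥ zero    _∙_ ε f = ≡.refl
fold-⊥ (suc n) _∙_ ε f = fold-⊥ n _∙_ ε (f ∘ suc)

-- The parts of A up to i and beyond i. The recursion lets sums over them unfold along with the head
-- of A.
_↓_ _↑_ : ∀ {n} → Subset n → Fin n → Subset n
(s ∷ A) ↓ zero  = s ∷ ⊥
(s ∷ A) ↓ suc i = s ∷ (A ↓ i)
(s ∷ A) ↑ zero  = outside ∷ A
(s ∷ A) ↑ suc i = outside ∷ (A ↑ i)

∈-↓⁺ : ∀ {n} {A : Subset n} {i j} → j ∈ A → j Fin.≤ i → j ∈ A ↓ i
∈-↓⁺ {i = zero}  here        _         = here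
∈-↓⁺ {i = suc i} here        _         = here
∈-↓⁺ {i = suc i} (there j∈A) (s≤s j≤i) = there (∈-↓⁺ j∈A j≤i)

∈-↓⁻ : ∀ {n} (A : Subset n) i {j} → j ∈ A ↓ i → j ∈ A × j Fin.≤ i
∈-↓⁻ (s ∷ A) zero    here       = here , z≤n
∈-↓⁻ (s ∷ A) zero    (there j∈) = contradiction j∈ ∉⊥
∈-↓⁻ (s ∷ A) (suc i) here       = here , z≤n
∈-↓⁻ (s ∷ A) (suc i) (there j∈) with j∈A , j≤i ← ∈-↓⁻ A i j∈ = there j∈A , s≤s j≤i

∈-↑⁺ : ∀ {n} {A : Subset n} {i j} → j ∈ A → i Fin.< j → j ∈ A ↑ i
∈-↑⁺ {i = zero}  (there j∈A) _         = there j∈A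
∈-↑⁺ {i = suc i} (there j∈A) (s≤s i<j) = there (∈-↑⁺ j∈A i<j)

∈-↑⁻ : ∀ {n} (A : Subset n) i {j} → j ∈ A ↑ i → j ∈ A × i Fin.< j
∈-↑⁻ (s ∷ A) zero    (there j∈) = there j∈ , s≤s z≤n
∈-↑⁻ (s ∷ A) (suc i) (there j∈) with j∈A , i<j ← ∈-↑⁻ A i j∈ = there j∈A , s≤s i<j

∣A∣≢0 : ∀ {n} {A : Subset n} → Nonempty A → ∣ A ∣ ≢ 0
∣A∣≢0 {A = outside ∷ A} (suc i , there i∈A) = ∣A∣≢0 (i , i∈A)
∣A∣≢0 {A = inside  ∷ A} _ ()

module Coefficients {c ℓ} (R : CommutativeSemiring c ℓ) where
  open CommutativeSemiring R hiding (zero)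
  open Squarefree R
  open Weights
  open SemiringSolver R using (solve; _:=_; _:+_; _:*_; con)
  open SetoidReasoning setoid
  private module E n = CommutativeSemiring (algebra n)

  ∑∈ ∏∈ : ∀ {n} → Subset n → (Fin n → Carrier) → Carrier
  ∑∈ = fold _+_ 0#
  ∏∈ = fold _*_ 1#

  ∏∈-cong : ∀ {n} (S : Subset n) {f g} → (∀ i → f i ≈ g i) → ∏∈ S f ≈ ∏∈ S g
  ∏∈-cong []            f≈g = refl
  ∏∈-cong (outside ∷ S) f≈g = ∏∈-cong S (f≈g ∘ suc)
  ∏∈-cong (inside  ∷ S) f≈g = *-cong (f≈g zero) (∏∈-cong S (f≈g ∘ suc))

  -- Each element of A is sent either to C or to B, by the same two-term recursion as the
  -- ε-component of a product of dual numbers.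
  ∑⊔ : ∀ {n} → Subset n → (Subset n → Subset n → Carrier) → Carrier
  ∑⊔ []            h = h [] []
  ∑⊔ (outside ∷ A) h = ∑⊔ A (λ B C → h (outside ∷ B) (outside ∷ C))
  ∑⊔ (inside  ∷ A) h = ∑⊔ A (λ B C → h (outside ∷ B) (inside ∷ C))
                     + ∑⊔ A (λ B C → h (inside ∷ B) (outside ∷ C))

  ∑⊔-cong : ∀ {n} (A : Subset n) {h k} → (∀ B C → h B C ≈ k B C) → ∑⊔ A h ≈ ∑⊔ A k
  ∑⊔-cong []            h≈k = h≈k [] []
  ∑⊔-cong (outside ∷ A) h≈k = ∑⊔-cong A (λ B C → h≈k (outside ∷ B) (outside ∷ C))
  ∑⊔-cong (inside  ∷ A) h≈k =
    +-cong (∑⊔-cong A (λ B C → h≈k (outside ∷ B) (inside ∷ C)))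
           (∑⊔-cong A (λ B C → h≈k (inside ∷ B) (outside ∷ C)))

  coeff : ∀ {n} → Subset n → E.Carrier n → Carrier
  coeff []            r       = r
  coeff (outside ∷ A) (f , g) = coeff A f
  coeff (inside  ∷ A) (f , g) = coeff A g

  coeff-cong : ∀ {n} (A : Subset n) {f g} → E._≈_ n f g → coeff A f ≈ coeff A g
  coeff-cong []            p       = p
  coeff-cong (outside ∷ A) (p , q) = coeff-cong A p
  coeff-cong (inside  ∷ A) (p , q) = coeff-cong A q

  coeff-0 : ∀ {n} (A : Subset n) → coeff A (E.0# n) ≡ 0#
  coeff-0 []            = ≡.refl
  coeff-0 (outside ∷ A) = coeff-0 A
  coeff-0 (inside  ∷ A) = coeff-0 A

  coeff-+ : ∀ {n} (A : Subset n) f g → coeff A (E._+_ n f g) ≡ coeff A f + coeff A g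
  coeff-+ []            f g = ≡.refl
  coeff-+ (outside ∷ A) f g = coeff-+ A (proj₁ f) (proj₁ g)
  coeff-+ (inside  ∷ A) f g = coeff-+ A (proj₂ f) (proj₂ g)

  coeff-* : ∀ {n} (A : Subset n) f g →
    coeff A (E._*_ n f g) ≈ ∑⊔ A (λ B C → coeff B f * coeff C g)
  coeff-* []            f g = refl
  coeff-* (outside ∷ A) f g = coeff-* A (proj₁ f) (proj₁ g)
  coeff-* (inside  ∷ A) f g = trans (reflexive (coeff-+ A _ _))
    (+-cong (coeff-* A (proj₁ f) (proj₂ g)) (coeff-* A (proj₂ f) (proj₁ g)))

  coeff-ι* : ∀ {n} (A : Subset n) r f → coeff A (E._*_ n (ι n r) f) ≈ r * coeff A f
  coeff-ι* []                    r f = refl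
  coeff-ι* (outside ∷ A)         r f = coeff-ι* A r (proj₁ f)
  coeff-ι* {suc n} (inside  ∷ A) r f = trans
    (coeff-cong A (E.trans n (E.+-congˡ n (E.zeroˡ n _)) (E.+-identityʳ n _)))
    (coeff-ι* A r (proj₂ f))

  -- By the Leibniz rule, the monomial of A is an eigenvector whose eigenvalue collects one weight
  -- from each element of A.
  coeff-∂ : ∀ {n} (A : Subset n) w f → coeff A (∂ n w f) ≈ ∑∈ A w * coeff A f
  coeff-∂ []            w f = sym (zeroˡ f)
  coeff-∂ (outside ∷ A) w f = coeff-∂ A (w ∘ suc) (proj₁ f)
  coeff-∂ {suc n} (inside ∷ A) w (_ , g) = begin
    coeff A (E._+_ n (E._*_ n (ι n (w zero)) g) (∂ n (w ∘ suc) g))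
      ≡⟨ coeff-+ A _ _ ⟩
    coeff A (E._*_ n (ι n (w zero)) g) + coeff A (∂ n (w ∘ suc) g)
      ≈⟨ +-cong (coeff-ι* A _ g) (coeff-∂ A (w ∘ suc) g) ⟩
    w zero * coeff A g + ∑∈ A (w ∘ suc) * coeff A g
      ≈⟨ distribʳ _ _ _ ⟨
    (w zero + ∑∈ A (w ∘ suc)) * coeff A g ∎

  coeff-1-⊥ : ∀ n → coeff (⊥ {n}) (E.1# n) ≡ 1#
  coeff-1-⊥ zero    = ≡.refl
  coeff-1-⊥ (suc n) = coeff-1-⊥ n

  coeff-1-nonempty : ∀ {n} (A : Subset n) → Nonempty A → coeff A (E.1# n) ≡ 0#
  coeff-1-nonempty (outside ∷ A) (suc i , there i∈A) = coeff-1-nonempty A (i , i∈A)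
  coeff-1-nonempty (inside  ∷ A) _ = coeff-0 A

  coeff-G-⊥ : ∀ n d s → coeff (⊥ {n}) (G n d s) ≡ 0#
  coeff-G-⊥ zero    d s = ≡.refl
  coeff-G-⊥ (suc n) d s = coeff-G-⊥ n (tail d) s

  coeff-F : ∀ {n} d s (A : Subset n) →
    coeff A (F n d s) ≈ coeff A (E.1# n) + s * coeff A (G n d s)
  coeff-F {n} d s A = trans (reflexive (coeff-+ A _ _)) (+-congˡ (coeff-ι* A s (G n d s)))

  coeff-F-⊥ : ∀ n d s → coeff (⊥ {n}) (F n d s) ≈ 1#
  coeff-F-⊥ n d s = begin
    coeff (⊥ {n}) (F n d s)
      ≈⟨ coeff-F d s (⊥ {n}) ⟩
    coeff (⊥ {n}) (E.1# n) + s * coeff (⊥ {n}) (G n d s)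
      ≡⟨ ≡.cong₂ (λ a b → a + s * b) (coeff-1-⊥ n) (coeff-G-⊥ n d s) ⟩
    1# + s * 0#
      ≈⟨ trans (+-congˡ (zeroʳ s)) (+-identityʳ 1#) ⟩
    1# ∎

  coeff-F-nonempty : ∀ {n} d s (A : Subset n) → Nonempty A →
    coeff A (F n d s) ≈ s * coeff A (G n d s)
  coeff-F-nonempty {n} d s A ne = begin
    coeff A (F n d s)                        ≈⟨ coeff-F d s A ⟩
    coeff A (E.1# n) + s * coeff A (G n d s) ≡⟨ ≡.cong (_+ s * coeff A (G n d s)) (coeff-1-nonempty A ne) ⟩
    0# + s * coeff A (G n d s)               ≈⟨ +-identityˡ _ ⟩
    s * coeff A (G n d s)                    ∎

  coeff-Q : ∀ {n} d s (A : Subset n) → let t = s + x d zero in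
    coeff A (Q n d s) ≈ y d zero * coeff A (F n (tail d) t)
      + x d zero * (∑∈ A (λ j → z d zero (suc j)) * coeff A (G n (tail d) t))
  coeff-Q {n} d s A = trans (reflexive (coeff-+ A _ _))
    (+-cong (coeff-ι* A _ _) (trans (coeff-ι* A _ _) (*-congˡ (coeff-∂ A _ _))))

  -- The factor at i in Θ_{A ∪ {0}} with x₀ = s: the element 0 lies below i, so it adds s to the
  -- first sum and nothing to the second.
  factorAt : ∀ {n} → Weights Carrier n → Carrier → Subset n → Fin n → Carrier
  factorAt d s A i = y d i * (s + ∑∈ (A ↓ i) (x d)) + x d i * ∑∈ (A ↑ i) (z d i)

  -- The x of the least element enters the first sum of every later factor. Removing that element
  -- therefore splits off its own factor and leaves the product for the rest at s + x.
  coeff-G : ∀ {n} d s (A : Subset n) (ne : Nonempty A) →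
    coeff A (G n d s) ≈ y d (Defs.max A ne) * ∏∈ (A - Defs.max A ne) (factorAt d s A)
  coeff-G {suc n} d s (outside ∷ A) (suc i , there i∈A) with nonempty? A
  ... | yes ne = coeff-G (tail d) s A ne
  ... | no ¬ne = contradiction (i , i∈A) ¬ne
  coeff-G {suc n} d s (inside ∷ A) _ with nonempty? A
  ... | yes ne = begin
    coeff A (Q n d s)
      ≈⟨ coeff-Q d s A ⟩
    y₀ * coeff A (F n d′ t) + x₀ * (Z * coeff A (G n d′ t))
      ≈⟨ +-congʳ (*-congˡ (coeff-F-nonempty d′ t A ne)) ⟩
    y₀ * (t * coeff A (G n d′ t)) + x₀ * (Z * coeff A (G n d′ t))
      ≈⟨ solve 5 (λ y t x z g → y :* (t :* g) :+ x :* (z :* g) := (y :* t :+ x :* z) :* g)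
           refl y₀ t x₀ Z (coeff A (G n d′ t)) ⟩
    (y₀ * t + x₀ * Z) * coeff A (G n d′ t)
      ≈⟨ *-cong (+-congʳ (*-congˡ (+-congˡ x₀≈∑)))
           (trans (coeff-G d′ t A ne)
             (*-congˡ (∏∈-cong (A - Defs.max A ne)
               λ i → +-congʳ (*-congˡ (+-assoc s x₀ (∑∈ (A ↓ i) (x d′))))))) ⟩
    factorAt d s (inside ∷ A) zero
      * (y d′ m * ∏∈ (A - m) (factorAt d s (inside ∷ A) ∘ suc))
      ≈⟨ solve 3 (λ f y p → f :* (y :* p) := y :* (f :* p)) refl _ _ _ ⟩
    y d′ m * (factorAt d s (inside ∷ A) zero
      * ∏∈ (A - m) (factorAt d s (inside ∷ A) ∘ suc)) ∎
    where
    d′ = tail d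
    m = Defs.max A ne
    x₀ = x d zero
    y₀ = y d zero
    t = s + x₀
    Z = ∑∈ A (λ j → z d zero (suc j))
    x₀≈∑ : x₀ ≈ x₀ + ∑∈ ⊥ (x d′)
    x₀≈∑ = sym (trans (+-congˡ (reflexive (fold-⊥ n _+_ 0# (x d′)))) (+-identityʳ x₀))
  -- The least element is also the greatest: G contributes 0, and the constant term 1 of F leaves y₀
  -- with an empty product.
  ... | no ¬ne rewrite Empty-unique ¬ne = begin
    coeff (⊥ {n}) (Q n d s)
      ≈⟨ coeff-Q d s (⊥ {n}) ⟩
    y₀ * coeff (⊥ {n}) (F n d′ t) + x₀ * (∑∈ ⊥ z₀ * coeff (⊥ {n}) (G n d′ t))
      ≈⟨ +-cong (*-congˡ (coeff-F-⊥ n d′ t))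
           (*-congˡ (*-congˡ (reflexive (coeff-G-⊥ n d′ t)))) ⟩
    y₀ * 1# + x₀ * (∑∈ ⊥ z₀ * 0#)
      ≈⟨ solve 3 (λ y x z → y :* con 1 :+ x :* (z :* con 0) := y :* con 1)
           refl y₀ x₀ (∑∈ ⊥ z₀) ⟩
    y₀ * 1#
      ≡⟨ ≡.cong (y₀ *_) (≡.trans
           (≡.cong (λ S → ∏∈ S (factorAt d s (inside ∷ ⊥) ∘ suc)) (p─⊥≡p ⊥))
           (fold-⊥ n _*_ 1# _)) ⟨
    y₀ * ∏∈ (⊥ ─ ⊥) (factorAt d s (inside ∷ ⊥) ∘ suc) ∎
    where
    d′ = tail d
    x₀ = x d zero
    y₀ = y d zero
    t = s + x₀
    z₀ = λ j → z d zero (suc j)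

-- Evaluation of Θ

open import Defs

polynomials : CommutativeSemiring 0ℓ 0ℓ
polynomials = CommutativeRing.commutativeSemiring (polynomialRing Indeterminate)

open CommutativeSemiring polynomials
  using (setoid; reflexive; +-congˡ; *-congˡ; +-identityʳ)
open Squarefree polynomials
open Coefficients polynomials
open SetoidReasoning setoid

-- Extended by 0 to the pairs with i > j.
y-total : ℕ → ℕ → Poly
y-total i j with i ℕ.≤? j
... | yes i≤j = var (y i j i≤j)
... | no  _   = 0#

y-total-≤ : ∀ {i j} (i≤j : i ≤ j) → var (y i j i≤j) ≡ y-total i j
y-total-≤ {i} {j} i≤j with i ℕ.≤? j
-- The bound in `y` is irrelevant, so the two proofs give the same indeterminate.
... | yes _  = ≡.refl
... | no i≰j = contradiction i≤j i≰j

-- The position i : Fin n stands for the positive integer suc i.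
indeterminates : ∀ n → Weights Poly n
indeterminates n = record
  { x = λ i → var (x (suc (toℕ i)))
  ; y = λ i → var (y (suc (toℕ i)) (suc (toℕ i)) ℕ.≤-refl)
  ; z = λ i j → y-total (suc (toℕ i)) (suc (toℕ j))
  }

-- Serves sums and products alike, with φ a substitution for x₀. The enumeration `h` is general so
-- that the induction can replace it by `h ∘ suc`.
foldr-terms : ∀ {_∙_ : Op₂ Poly} {ε} → Congruent₂ _≈_ _∙_ →
  (φ : Poly → Poly) → (∀ p q → φ (p ∙ q) ≡ φ p ∙ φ q) → φ ε ≡ ε →
  ∀ {I : Set} {n} (h : Fin n → I) {P : Pred I 0ℓ} (P? : Decidable P) f (S : Subset n) g →
  (∀ {i} → P (h i) → i ∈ S) → (∀ {i} → i ∈ S → P (h i)) → (∀ i p → φ (f (h i) p) ≈ g i) →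
  φ (foldr _∙_ ε (terms (tabulate h) P? f)) ≈ fold _∙_ ε S g
foldr-terms ∙-cong φ φ-∙ φ-ε h P? f [] g P⇒S S⇒P f≈g = reflexive φ-ε
foldr-terms ∙-cong φ φ-∙ φ-ε h P? f (outside ∷ S) g P⇒S S⇒P f≈g with P? (h zero)
... | yes p = contradiction (P⇒S p) λ ()
... | no  _ = foldr-terms ∙-cong φ φ-∙ φ-ε (h ∘ suc) P? f S (g ∘ suc)
                (drop-there ∘ P⇒S) (S⇒P ∘ there) (f≈g ∘ suc)
foldr-terms ∙-cong φ φ-∙ φ-ε h P? f (inside ∷ S) g P⇒S S⇒P f≈g with P? (h zero)
... | no ¬p = contradiction (S⇒P here) ¬p
... | yes p = trans (reflexive (φ-∙ _ _)) (∙-cong (f≈g zero p)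
                (foldr-terms ∙-cong φ φ-∙ φ-ε (h ∘ suc) P? f S (g ∘ suc)
                  (drop-there ∘ P⇒S) (S⇒P ∘ there) (f≈g ∘ suc)))

∑-∣x₀= : ∀ s {n} {P : Pred (Fin n) 0ℓ} (P? : Decidable P) f (S : Subset n) g →
  (∀ {i} → P i → i ∈ S) → (∀ {i} → i ∈ S → P i) → (∀ i p → f i p ∣x₀= s ≈ g i) →
  (∑[ allFin n ∣ P? ] f) ∣x₀= s ≈ ∑∈ S g
∑-∣x₀= s = foldr-terms +-cong (_∣x₀= s) (λ _ _ → ≡.refl) ≡.refl id

∏-∣x₀= : ∀ s {n} {P : Pred (Fin n) 0ℓ} (P? : Decidable P) f (S : Subset n) g →
  (∀ {i} → P i → i ∈ S) → (∀ {i} → i ∈ S → P i) → (∀ i p → f i p ∣x₀= s ≈ g i) →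
  (∏[ allFin n ∣ P? ] f) ∣x₀= s ≈ ∏∈ S g
∏-∣x₀= s = foldr-terms *-cong (_∣x₀= s) (λ _ _ → ≡.refl) ≡.refl id

factor-∣x₀= : ∀ {n} (A : Subset n) s i →
  factor (inside ∷ A) (suc i) ∣x₀= s ≈ factorAt (indeterminates n) s A i
factor-∣x₀= {n} A s i = +-cong
  (*-congˡ (∑-∣x₀= s (λ j → j ∈? A₀ ×-dec j Fin.≤? suc i) (λ j _ → var (x (toℕ j)))
    -- Position 0 lies in this set, and x₀ there becomes s.
    (A₀ ↓ suc i) (λ { zero → s ; (suc j) → var (x (suc (toℕ j))) })
    (λ (j∈A , j≤i) → ∈-↓⁺ j∈A j≤i) (∈-↓⁻ A₀ (suc i))
    λ { zero _ → refl ; (suc j) _ → refl }))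
  (*-congˡ (∑-∣x₀= s (λ j → j ∈? A₀ ×-dec suc i Fin.<? j)
    (λ j (_ , i<j) → var (y (suc (toℕ i)) (toℕ j) (ℕ.<⇒≤ i<j)))
    -- Position 0 lies outside this set; 0 is a default value.
    (A₀ ↑ suc i) (λ { zero → 0# ; (suc j) → y-total (suc (toℕ i)) (suc (toℕ j)) })
    (λ (j∈A , i<j) → ∈-↑⁺ j∈A i<j) (∈-↑⁻ A₀ (suc i))
    λ { zero (_ , ()) ; (suc j) (_ , i<j) → reflexive (y-total-≤ (ℕ.<⇒≤ i<j)) }))
  where A₀ = inside ∷ A

-- The minimum is 0, whose x₀ = s is the s in F = 1 + s G. The value 1 of Θ at a singleton is the
-- constant term of F.
Θ-coeff : ∀ {n} (A : Subset n) s .(ne : Nonempty (inside ∷ A)) →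
  Θ (inside ∷ A) ne ∣x₀= s ≈ coeff A (F n (indeterminates n) s)
Θ-coeff {n} A s _ with nonempty? A
... | no ¬ne rewrite Empty-unique ¬ne | ∣⊥∣≡0 n = sym (coeff-F-⊥ n (indeterminates n) s)
-- Exposing |A| as a successor makes the test |A ∪ {0}| = 1 compute to false.
... | yes ne with ∣ A ∣ | ∣A∣≢0 ne
...   | zero  | ∣A∣≢0 = contradiction ≡.refl ∣A∣≢0
...   | suc _ | _ = begin
  s * yₘ * (∏[ allFin (suc n) ∣ (_∈? A₀) ] (λ i _ → factor (inside ∷ A) i) ∣x₀= s)
    ≈⟨ *-congˡ (∏-∣x₀= s (_∈? A₀) (λ i _ → factor (inside ∷ A) i)
         (outside ∷ (A - max A ne))
         -- Position 0 has been removed from the set; its entry is chosen to make the required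
         -- equality hold by `refl`.
         (λ { zero → factor (inside ∷ A) zero ∣x₀= s ; (suc i) → factorAt d s A i })
         (λ {i} → ≡.subst (i ∈_) removed) (λ {i} → ≡.subst (i ∈_) (≡.sym removed))
         λ { zero _ → refl ; (suc i) _ → factor-∣x₀= A s i }) ⟩
  s * yₘ * ∏∈ (A - max A ne) (factorAt d s A)
    ≈⟨ *-assoc _ _ _ ⟩
  s * (yₘ * ∏∈ (A - max A ne) (factorAt d s A))
    ≈⟨ *-congˡ (coeff-G d s A ne) ⟨
  s * coeff A (G n d s)
    ≈⟨ coeff-F-nonempty d s A ne ⟨
  coeff A (F n d s) ∎
  where
  d = indeterminates n
  yₘ = Weights.y d (max A ne)
  A₀ = (inside ∷ A) - suc (max A ne) - zero
  removed : A₀ ≡ outside ∷ (A - max A ne)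
  removed = ≡.cong (outside ∷_) (p─⊥≡p (A - max A ne))

-- Sums over pairs of subsets

∑ᴸ : ∀ {I : Set} → List I → (I → Poly) → Poly
∑ᴸ is f = foldr (λ i p → f i + p) 0# is

∑ᴸ-cong : ∀ {I : Set} (is : List I) {f g} → (∀ i → f i ≈ g i) → ∑ᴸ is f ≈ ∑ᴸ is g
∑ᴸ-cong []       f≈g = refl
∑ᴸ-cong (i ∷ is) f≈g = +-cong (f≈g i) (∑ᴸ-cong is f≈g)

∑ᴸ-0 : ∀ {I : Set} (is : List I) → ∑ᴸ is (λ _ → 0#) ≈ 0#
∑ᴸ-0 []       = refl
∑ᴸ-0 (i ∷ is) = trans (+-identityˡ _) (∑ᴸ-0 is)

∑ᴸ-+ : ∀ {I : Set} (is : List I) f g → ∑ᴸ is (λ i → f i + g i) ≈ ∑ᴸ is f + ∑ᴸ is g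
∑ᴸ-+ []       f g = sym (+-identityˡ 0#)
∑ᴸ-+ (i ∷ is) f g = trans (+-congˡ (∑ᴸ-+ is f g))
  (solve 4 (λ a b c d → (a :+ b) :+ (c :+ d) := (a :+ c) :+ (b :+ d)) refl _ _ _ _)
  where open SemiringSolver polynomials

∑ᴸ-map : ∀ {I J : Set} (h : I → J) is f → ∑ᴸ (map h is) f ≡ ∑ᴸ is (f ∘ h)
∑ᴸ-map h []       f = ≡.refl
∑ᴸ-map h (i ∷ is) f = ≡.cong (f (h i) +_) (∑ᴸ-map h is f)

∑ᴸ-++ : ∀ {I : Set} (is js : List I) f → ∑ᴸ (is ++ js) f ≈ ∑ᴸ is f + ∑ᴸ js f
∑ᴸ-++ []       js f = sym (+-identityˡ _)
∑ᴸ-++ (i ∷ is) js f = trans (+-congˡ (∑ᴸ-++ is js f)) (sym (+-assoc _ _ _))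

∑ᴸ-cartesianProduct : ∀ {I J : Set} (is : List I) (js : List J) f →
  ∑ᴸ (cartesianProduct is js) f ≈ ∑ᴸ is (λ i → ∑ᴸ js (λ j → f (i , j)))
∑ᴸ-cartesianProduct []       js f = refl
∑ᴸ-cartesianProduct (i ∷ is) js f = trans (∑ᴸ-++ (map (i ,_) js) _ f)
  (+-cong (reflexive (∑ᴸ-map (i ,_) js f)) (∑ᴸ-cartesianProduct is js f))

-- Trading the filter for zero terms makes the range a full product of lists, so the sum can be
-- iterated.
∑-if : ∀ {I : Set} {P : Pred I 0ℓ} is (P? : Decidable P) (f : I → Poly) →
  ∑[ is ∣ P? ] (λ i _ → f i) ≈ ∑ᴸ is (λ i → if does (P? i) then f i else 0#)
∑-if []       P? f = refl
∑-if (i ∷ is) P? f with P? i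
... | yes _ = +-congˡ (∑-if is P? f)
... | no  _ = trans (∑-if is P? f) (sym (+-identityˡ _))

∑ᴸ-subsets-suc : ∀ n f → ∑ᴸ (subsets (suc n)) f
  ≈ ∑ᴸ (subsets n) (f ∘ (outside ∷_)) + ∑ᴸ (subsets n) (f ∘ (inside ∷_))
∑ᴸ-subsets-suc n f = trans (∑ᴸ-++ (map (outside ∷_) (subsets n)) _ f)
  (reflexive (≡.cong₂ _+_ (∑ᴸ-map (outside ∷_) (subsets n) f) (∑ᴸ-map (inside ∷_) (subsets n) f)))

∑² : ∀ n → (Subset n → Subset n → Poly) → Poly
∑² n k = ∑ᴸ (subsets n) (λ B → ∑ᴸ (subsets n) (k B))

∑²-0 : ∀ n {k} → (∀ B C → k B C ≈ 0#) → ∑² n k ≈ 0#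
∑²-0 n k≈0 = trans (∑ᴸ-cong (subsets n) λ B →
  trans (∑ᴸ-cong (subsets n) (k≈0 B)) (∑ᴸ-0 (subsets n))) (∑ᴸ-0 (subsets n))

∑²-suc : ∀ n k → ∑² (suc n) k ≈
  (∑² n (λ B C → k (outside ∷ B) (outside ∷ C)) + ∑² n (λ B C → k (outside ∷ B) (inside ∷ C)))
  + (∑² n (λ B C → k (inside ∷ B) (outside ∷ C)) + ∑² n (λ B C → k (inside ∷ B) (inside ∷ C)))
∑²-suc n k = trans (∑ᴸ-subsets-suc n _) (+-cong (split outside) (split inside))
  where
  split : ∀ b → ∑ᴸ (subsets n) (λ B → ∑ᴸ (subsets (suc n)) (k (b ∷ B)))
    ≈ ∑² n (λ B C → k (b ∷ B) (outside ∷ C)) + ∑² n (λ B C → k (b ∷ B) (inside ∷ C))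
  split b = trans (∑ᴸ-cong (subsets n) (λ B → ∑ᴸ-subsets-suc n (k (b ∷ B)))) (∑ᴸ-+ (subsets n) _ _)

-- The least position splits the double sum into four blocks. If it is outside A, only the block
-- with it in neither set survives; if it is inside, only the two with it in exactly one.
∑²-⊔ : ∀ {n} (A : Subset n) h →
  ∑² n (λ B C → if does (B ⊔ C ≟ A) then h B C else 0#) ≈ ∑⊔ A h
∑²-⊔ [] h = trans (+-identityʳ _) (+-identityʳ _)
∑²-⊔ {suc n} (outside ∷ A) h = trans (∑²-suc n _) (trans
  (+-cong (+-cong (∑²-⊔ A _) (∑²-0 n λ _ _ → refl)) (+-cong (∑²-0 n λ _ _ → refl) (∑²-0 n λ _ _ → refl)))
  (solve 1 (λ a → (a :+ con 0) :+ (con 0 :+ con 0) := a) refl _))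
  where open SemiringSolver polynomials
∑²-⊔ {suc n} (inside ∷ A) h = trans (∑²-suc n _) (trans
  (+-cong (+-cong (∑²-0 n λ _ _ → refl) (∑²-⊔ A _)) (+-cong (∑²-⊔ A _) (∑²-0 n 0-on-overlaps)))
  (solve 2 (λ a b → (con 0 :+ a) :+ (b :+ con 0) := a :+ b) refl _ _))
  where
  open SemiringSolver polynomials
  0-on-overlaps : ∀ B C →
    (if does ((inside ∷ B) ⊔ (inside ∷ C) ≟ (inside ∷ A)) then h (inside ∷ B) (inside ∷ C) else 0#) ≈ 0#
  -- Only the second conjunct, on the intersection, computes to false here; the test on the union is
  -- still open.
  0-on-overlaps B C rewrite ∧-zeroʳ (does (B ∪ C ≟ A)) = refl

∑-pairs : ∀ {n} (A : Subset n) h →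
  ∑[ pairs n ∣ (λ (B , C) → B ⊔ C ≟ A) ] (λ (B , C) _ → h B C) ≈ ∑⊔ A h
∑-pairs {n} A h = trans (∑-if (pairs n) (λ (B , C) → B ⊔ C ≟ A) (λ (B , C) → h B C))
  (trans (∑ᴸ-cartesianProduct (subsets n) (subsets n) _) (∑²-⊔ A h))

-- The union computes only to `inside ∷ (A ∪ ⊥)`; irrelevance of `ne` allows the tail to be
-- rewritten to A.
Θ-∪⁅0⁆ : ∀ {n} (A : Subset n) s .(ne : Nonempty ((outside ∷ A) ∪ ⁅ zero ⁆)) →
  Θ ((outside ∷ A) ∪ ⁅ zero ⁆) ne ∣x₀= s ≈ coeff A (F n (indeterminates n) s)
Θ-∪⁅0⁆ {n} A s ne rewrite ∪-identityʳ A = Θ-coeff A s ne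

theorem1p3 : (n : ℕ) (A : Subset (suc n)) → zero ∉ A →
    Θ (A ∪ ⁅ zero ⁆) (∪⁅0⁆-nonempty A) ∣x₀= (var u + var v)
      ≈ ∑[ pairs (suc n) ∣ (λ (B , C) → B ⊔ C ≟ A) ] (λ (B , C) _ →
            Θ (B ∪ ⁅ zero ⁆) (∪⁅0⁆-nonempty B) ∣x₀= var u
          * Θ (C ∪ ⁅ zero ⁆) (∪⁅0⁆-nonempty C) ∣x₀= var v)
theorem1p3 n (inside  ∷ A) 0∉A = contradiction here 0∉A
theorem1p3 n (outside ∷ A) _   = begin
  Θ ((outside ∷ A) ∪ ⁅ zero ⁆) _ ∣x₀= (var u + var v)
    ≈⟨ Θ-∪⁅0⁆ A (var u + var v) _ ⟩
  coeff A (F n d (var u + var v))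
    ≈⟨ coeff-cong A (F-+ n d (var u) (var v)) ⟩
  coeff A (CommutativeSemiring._*_ (algebra n) (F n d (var u)) (F n d (var v)))
    ≈⟨ coeff-* A _ _ ⟩
  ∑⊔ A (λ B C → coeff B (F n d (var u)) * coeff C (F n d (var v)))
    ≈⟨ ∑⊔-cong A (λ B C → *-cong (Θ-∪⁅0⁆ B (var u) _) (Θ-∪⁅0⁆ C (var v) _)) ⟨
  _
    -- Since 0 is in neither part, `∑⊔` over `outside ∷ A` unfolds to `∑⊔` over A.
    ≈⟨ ∑-pairs (outside ∷ A) _ ⟨
  _ ∎
  where d = indeterminates n
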